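{- Let $\mathcal{M}$ be a map and let $I\subseteq R=\{0,1,2\}$. Then $\mathcal{M}$ is $I$-pseudo-orientable if and only if $\mathcal{M}$ is $(R\setminus I)$-colorable.
   Context: Map. A map $\mathcal{M}$ is an embedding of a graph (or pseudograph) on a compact connected surface such that the components of the complement (faces) are open disks. Choose a center in each face and a midpoint in each edge, and join each face-center to each incidence with the surrounding vertices and edge-midpoints; this, together with the original edges, divides the surface into triangles called flags. Combinatorially, a map is a pair $(\Omega,[r_0,r_1,r_2])$ where $\Omega$ is the (finite, since the surface is compact) set of flags, $r_0,r_1,r_2$ are permutations of $\Omega$ (acting on the right), $r_0,r_1,r_2$ and $r_0r_2$ are fixed-point-free of order 2, $r_0r_2=r_2r_0$, and $C(\mathcal{M})=\langle r_0,r_1,r_2\rangle$ is transitive on $\Omega$. Vertices, edges and faces correspond to orbits of $\langle r_1,r_2\rangle$, $\langle r_0,r_2\rangle$, $\langle r_0,r_1\rangle$ respectively. Sub-edges. The sides of the triangular flags are called sub-edges: type 0 joins an edge-midpoint to a face-center, type 1 joins a face-center to a vertex, type 2 joins a vertex to an edge-midpoint. Each flag $f$ has one side of each type, and $f$ is glued to the flag $fr_i$ along their common side of type $i$; the surface is obtained from the triangles by these gluings. Coloring. For $I\subseteq R$, an $I$-coloring of $\mathcal{M}$ is a function $a:\Omega\to\mathbb{Z}_2$ such that for every flag $f$ and every $j\in R$, $a(fr_j)\ne a(f)$ if $j\in I$ and $a(fr_j)=a(f)$ if $j\notin I$. $\mathcal{M}$ is $I$-colorable if it has an $I$-coloring.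 The map $X(\mathcal{M},I)$. For nonempty $I\subseteq R$, $X(\mathcal{M},I)$ is the map on the same surface whose faces are the regions formed by conjoining flags that are connected by each $r_i$ with $i\notin I$ (so flags $f$ and $fr_i$ lie in the same region for $i\notin I$); its graph is the union of the sub-edges of types in $I$, which form the boundaries of the regions. (For instance $X(\mathcal{M},\{2\})=\mathcal{M}$.) Face pseudo-orientation. A map is face pseudo-orientable if one can assign a circular arrow (a direction of rotation) to each face so that at each edge the arrows of the two faces (possibly the same face twice) meeting along the edge flow along the edge in the same direction; equivalently, the edges can be directed so that the cycle of edges around each face is consistently directed. In $X(\mathcal{M},I)$ this condition is imposed along every sub-edge of type in $I$. $I$-pseudo-orientable. For nonempty $I\subseteq R$, $\mathcal{M}$ is $I$-pseudo-orientable if $X(\mathcal{M},I)$ is face pseudo-orientable. $\mathcal{M}$ is $\emptyset$-pseudo-orientable if it is orientable, i.e. if the surface on which it is embedded is orientable. -}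

module Defs where

open import Algebra.Definitions using (Involutive)
open import Data.Empty using (⊥-elim)
open import Data.Fin using (Fin; zero; suc; punchIn; punchOut)
open import Data.Fin.Patterns using (0F; 1F; 2F)
open import Data.Fin.Properties
  using (_≟_; *↔×; punchInᵢ≢i; punchIn-punchOut; punchOut-punchIn; punchOut-cong)
open import Data.Fin.Subset
  using (Subset; inside; outside; _∈_; _∉_; Nonempty; ∣_∣; ⁅_⁆; ∁; ⊤; ⊥)
open import Data.Fin.Subset.Properties
  using (_∈?_; ∈⊤; x∈∁p⇒x∉p; x∉p⇒x∈∁p)
open import Data.Nat using (ℕ; _*_)
open import Data.Parity.Base using (Parity)
open import Data.Product using (Σ; ∃; _×_; _,_)
open import Data.Product.Function.NonDependent.Propositional using (_×-↔_)
open import Data.Vec using ([]; _∷_; here; there)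
open import Data.Vec.Properties.WithK using ([]=-irrelevant)
open import Function using (_∘_)
open import Function.Bundles using (_↔_; _⇔_; mk↔ₛ′; mk⇔)
open import Function.Construct.Composition using (_↔-∘_)
open import Function.Construct.Identity using (↔-id)
open import Function.Construct.Symmetry using (↔-sym)
open import Relation.Binary.Construct.Closure.ReflexiveTransitive
  using (Star; ε; _◅_; _◅◅_)
open import Relation.Binary.PropositionalEquality
  using (_≡_; _≢_; refl; sym; trans; cong; cong₂; subst)
open import Relation.Nullary using (Dec; yes; no; recompute)
open import Relation.Nullary.Negation using (contradiction)
open import Relation.Nullary.Recomputable using (¬-recompute)

R : Set
R = Fin 3

-- Orbits of the group generated by the r j with j ∈ J.  The generators are
-- going to be involutions, so words in them without inverses suffice.

data Step {Ω : Set} (r : R → Ω → Ω) (J : Subset 3) : Ω → Ω → Set where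
  step : ∀ {f} j → j ∈ J → Step r J f (r j f)

SameOrbit : {Ω : Set} → (R → Ω → Ω) → Subset 3 → Ω → Ω → Set
SameOrbit r J = Star (Step r J)

-- r i f is the flag written f rᵢ in right-action notation.  That r₀r₂ has
-- order 2 follows from r-involutive and r₀r₂-comm.  The field root only says
-- that the set of flags is nonempty.

record Map : Set₁ where
  field
    Flag         : Set
    size         : ℕ
    finite       : Flag ↔ Fin size
    root         : Flag
    r            : R → Flag → Flag
    r-involutive : ∀ i → Involutive _≡_ (r i)
    r-fpf        : ∀ i f → r i f ≢ f
    r₀r₂-comm    : ∀ f → r 2F (r 0F f) ≡ r 0F (r 2F f)
    r₀r₂-fpf     : ∀ f → r 2F (r 0F f) ≢ f
    transitive   : ∀ f g → SameOrbit r ⊤ f g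

open Map

IsColoring : (M : Map) → Subset 3 → (Flag M → Parity) → Set
IsColoring M I a =
  ∀ f j → (j ∈ I → a (r M j f) ≢ a f) × (j ∉ I → a (r M j f) ≡ a f)

Colorable : Map → Subset 3 → Set
Colorable M I = ∃ λ a → IsColoring M I a

-- A flag is a vertex, an edge at that vertex and a face along that edge.  The
-- circular arrow of the face runs along the edge, hence along the half of the
-- edge belonging to the flag, either away from the vertex or towards it.

data Flow : Set where
  outgoing incoming : Flow

-- A circular arrow in every face, recorded by its flow at each of the flags
-- of the face.  On its way round the boundary of the face the arrow
--   * runs through the midpoint of an edge from the flag f to r 0F f, away
--     from one end of the edge and towards the other;
--   * runs past a vertex from f to r 1F f, towards it along one edge and away
--     from it along the next.
-- A face is an orbit of ⟨r₀,r₁⟩, so nothing relates the arrows of different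
-- faces.

record CircularArrows (M : Map) : Set where
  field
    flow      : Flag M → Flow
    along     : ∀ f → flow (r M 0F f) ≢ flow f
    at-vertex : ∀ f → flow (r M 1F f) ≢ flow f

open CircularArrows

-- The flags f and r 2F f share the vertex and the edge but lie on the two
-- sides of the edge.

FacePseudoOrientable : Map → Set
FacePseudoOrientable M =
  Σ (CircularArrows M) λ A → ∀ f → flow A (r M 2F f) ≡ flow A f

-- The corners of the triangle f are numbered by the type of the opposite side:
-- 0F is the vertex, 1F the edge-midpoint, 2F the face-center.  Thus side i has
-- the two corners different from i as ends, and gluing f to r i f along side i
-- identifies the corners of f and r i f having the same number k ≢ i.

-- An orientation of a triangle is a cyclic order of its corners.

data CyclicOrder : Set where
  ⟨012⟩ ⟨021⟩ : CyclicOrder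

next : CyclicOrder → Fin 3 → Fin 3
next ⟨012⟩ 0F = 1F
next ⟨012⟩ 1F = 2F
next ⟨012⟩ 2F = 0F
next ⟨021⟩ 0F = 2F
next ⟨021⟩ 2F = 1F
next ⟨021⟩ 1F = 0F

-- The boundary of a triangle, run through in the given order, passes side i
-- from the corner after i to the corner after that.

tail head : CyclicOrder → R → Fin 3
tail o i = next o i
head o i = next o (next o i)

-- The surface triangulated by the flags is orientable: the triangles can be
-- oriented so that any two glued along a side induce opposite directions on it.

Orientable : Map → Set
Orientable M = Σ (Flag M → CyclicOrder) λ o →
  ∀ f i → tail (o (r M i f)) i ≡ head (o f) i × head (o (r M i f)) i ≡ tail (o f) i

-- For i ≢ k the remaining element of {0,1,2}; so third i k is the other end of
-- side i when k is one end, and also the other side at corner k when i is one.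
-- The values on the diagonal are chosen to make third i an involution.

third : Fin 3 → Fin 3 → Fin 3
third 0F 1F = 2F
third 0F 2F = 1F
third 1F 0F = 2F
third 1F 2F = 0F
third 2F 0F = 1F
third 2F 1F = 0F
third 0F 0F = 0F
third 1F 1F = 1F
third 2F 2F = 2F

third-comm : ∀ i k → third i k ≡ third k i
third-comm 0F 0F = refl
third-comm 0F 1F = refl
third-comm 0F 2F = refl
third-comm 1F 0F = refl
third-comm 1F 1F = refl
third-comm 1F 2F = refl
third-comm 2F 0F = refl
third-comm 2F 1F = refl
third-comm 2F 2F = refl

third-involutive : ∀ i k → third i (third i k) ≡ k
third-involutive 0F 0F = refl
third-involutive 0F 1F = refl
third-involutive 0F 2F = refl
third-involutive 1F 0F = refl
third-involutive 1F 1F = refl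
third-involutive 1F 2F = refl
third-involutive 2F 0F = refl
third-involutive 2F 1F = refl
third-involutive 2F 2F = refl

third-cancel : ∀ i k → third (third i k) k ≡ i
third-cancel i k = trans (third-comm (third i k) k)
  (trans (cong (third k) (third-comm i k)) (third-involutive k i))

third≢₁ : ∀ i k → k ≢ i → third i k ≢ i
third≢₁ 0F 0F k≢i = contradiction refl k≢i
third≢₁ 0F 1F _ ()
third≢₁ 0F 2F _ ()
third≢₁ 1F 0F _ ()
third≢₁ 1F 1F k≢i = contradiction refl k≢i
third≢₁ 1F 2F _ ()
third≢₁ 2F 0F _ ()
third≢₁ 2F 1F _ ()
third≢₁ 2F 2F k≢i = contradiction refl k≢i

third≢₂ : ∀ i k → k ≢ i → third i k ≢ k
third≢₂ i k k≢i e = third≢₁ k i (k≢i ∘ sym) (trans (third-comm k i) e)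

two-ends : ∀ i k l → k ≢ i → l ≢ i → l ≢ k → l ≡ third i k
two-ends 0F 0F _  p _ _ = contradiction refl p
two-ends 1F 1F _  p _ _ = contradiction refl p
two-ends 2F 2F _  p _ _ = contradiction refl p
two-ends 0F 1F 0F _ q _ = contradiction refl q
two-ends 0F 1F 1F _ _ s = contradiction refl s
two-ends 0F 1F 2F _ _ _ = refl
two-ends 0F 2F 0F _ q _ = contradiction refl q
two-ends 0F 2F 1F _ _ _ = refl
two-ends 0F 2F 2F _ _ s = contradiction refl s
two-ends 1F 0F 0F _ _ s = contradiction refl s
two-ends 1F 0F 1F _ q _ = contradiction refl q
two-ends 1F 0F 2F _ _ _ = refl
two-ends 1F 2F 0F _ _ _ = refl
two-ends 1F 2F 1F _ q _ = contradiction refl q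
two-ends 1F 2F 2F _ _ s = contradiction refl s
two-ends 2F 0F 0F _ _ s = contradiction refl s
two-ends 2F 0F 1F _ _ _ = refl
two-ends 2F 0F 2F _ q _ = contradiction refl q
two-ends 2F 1F 0F _ _ _ = refl
two-ends 2F 1F 1F _ _ s = contradiction refl s
two-ends 2F 1F 2F _ q _ = contradiction refl q

members↔ : ∀ {n} (p : Subset n) → Σ (Fin n) (_∈ p) ↔ Fin ∣ p ∣
members↔ [] = mk↔ₛ′ (λ { (() , _) }) (λ ()) (λ ()) (λ { (() , _) })
members↔ {ℕ.suc n} (inside ∷ p) = mk↔ₛ′ to from to-from from-to
  where
  module IH = Function.Bundles.Inverse (members↔ p)
  to : Σ (Fin (ℕ.suc n)) (_∈ inside ∷ p) → Fin (ℕ.suc ∣ p ∣)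
  to (zero  , _)         = zero
  to (suc i , there i∈p) = suc (IH.to (i , i∈p))
  shift : Σ (Fin n) (_∈ p) → Σ (Fin (ℕ.suc n)) (_∈ inside ∷ p)
  shift (i , i∈p) = suc i , there i∈p
  from : Fin (ℕ.suc ∣ p ∣) → Σ (Fin (ℕ.suc n)) (_∈ inside ∷ p)
  from zero    = zero , here
  from (suc k) = shift (IH.from k)
  to-from : ∀ k → to (from k) ≡ k
  to-from zero    = refl
  to-from (suc k) = cong suc (IH.strictlyInverseˡ k)
  from-to : ∀ x → from (to x) ≡ x
  from-to (zero  , here)      = refl
  from-to (suc i , there i∈p) = cong shift (IH.strictlyInverseʳ (i , i∈p))
members↔ {ℕ.suc n} (outside ∷ p) = mk↔ₛ′ to (shift ∘ IH.from) IH.strictlyInverseˡ from-to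
  where
  module IH = Function.Bundles.Inverse (members↔ p)
  shift : Σ (Fin n) (_∈ p) → Σ (Fin (ℕ.suc n)) (_∈ outside ∷ p)
  shift (i , i∈p) = suc i , there i∈p
  to : Σ (Fin (ℕ.suc n)) (_∈ outside ∷ p) → Fin ∣ p ∣
  to (suc i , there i∈p) = IH.to (i , i∈p)
  from-to : ∀ x → shift (IH.from (to x)) ≡ x
  from-to (suc i , there i∈p) = cong shift (IH.strictlyInverseʳ (i , i∈p))

-- The flags of X(M,I).  Its edges are the sub-edges of types in I and its
-- vertices are the ends of these (so the edge-midpoints of M are vertices of
-- X(M,I), of valence 2 for I = {2}).  A flag of X(M,I) consists of a face, an
-- edge on its boundary (with the side of the edge on which the face lies) and
-- an end of that edge, i.e. of a triangle of M lying in the face, a side of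
-- that triangle of type in I, and a corner of the triangle on that side.

record Incidence (Ω : Set) (I : Subset 3) : Set where
  constructor inc
  field
    flag         : Ω
    side         : R
    corner       : Fin 3
    .side∈I      : side ∈ I
    .corner≢side : corner ≢ side

open Incidence using (flag; side; corner)

module _ {Ω : Set} {I : Subset 3} where

  inc-≡ : {f g : Ω} {i j : R} {k l : Fin 3} →
          .{p : i ∈ I} .{q : j ∈ I} .{s : k ≢ i} .{t : l ≢ j} →
          f ≡ g → i ≡ j → k ≡ l → inc {I = I} f i k p s ≡ inc g j l q t
  inc-≡ refl refl refl = refl

  apart : (x : Incidence Ω I) → corner x ≢ side x
  apart (inc _ _ _ _ k≢i) = ¬-recompute k≢i

  member : (x : Incidence Ω I) → side x ∈ I
  member (inc _ i _ i∈I _) = recompute (i ∈? I) i∈I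

  incidences↔ : ∀ {n} → Ω ↔ Fin n → Incidence Ω I ↔ Fin (n * (∣ I ∣ * 2))
  incidences↔ Ω↔ =
    ↔-sym (*↔×) ↔-∘ ((Ω↔ ×-↔ ↔-sym *↔×) ↔-∘
      ((↔-id Ω ×-↔ (members↔ I ×-↔ ↔-id (Fin 2))) ↔-∘ unpack))
    where
    unpack : Incidence Ω I ↔ (Ω × Σ R (_∈ I) × Fin 2)
    unpack = mk↔ₛ′
      (λ x → flag x , (side x , member x) , punchOut (apart x ∘ sym))
      (λ { (f , (i , i∈I) , s) → inc f i (punchIn i s) i∈I (punchInᵢ≢i i s) })
      (λ { (f , (i , i∈I) , s) → cong₂ (λ p t → f , (i , p) , t)
             ([]=-irrelevant _ i∈I)
             (trans (punchOut-cong i refl) (punchOut-punchIn i)) })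
      (λ x → inc-≡ refl refl (punchIn-punchOut (apart x ∘ sym)))

-- The three involutions of X(M,I).  x₀ moves to the other end of the sub-edge,
-- and x₂ crosses the sub-edge.  x₁ keeps the face and the corner k of f = flag x,
-- and turns about that corner to the next sub-edge of type in I: the sides of f
-- at k have types i = side x and j = third i k, so this is side j of f if j ∈ I,
-- and otherwise, after crossing side j into r j f, it is side i of r j f.

module _ (M : Map) (I : Subset 3) where

  private
    XFlag : Set
    XFlag = Incidence (Flag M) I

  x₀ x₁ x₂ : XFlag → XFlag
  x₀ (inc f i k i∈I k≢i) = inc f i (third i k) i∈I (third≢₁ i k k≢i)
  x₁ (inc f i k i∈I k≢i) with third i k ∈? I
  ... | yes j∈I = inc f (third i k) k j∈I (third≢₂ i k k≢i ∘ sym)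
  ... | no  _   = inc (r M (third i k) f) i k i∈I k≢i
  x₂ (inc f i k i∈I k≢i) = inc (r M i f) i k i∈I k≢i

  x : R → XFlag → XFlag
  x 0F = x₀
  x 1F = x₁
  x 2F = x₂

  x₁-in : ∀ {f i j k} .{i∈I : i ∈ I} .{k≢i : k ≢ i} .{k≢j : k ≢ j} →
          j ≡ third i k → (j∈I : j ∈ I) →
          x₁ (inc f i k i∈I k≢i) ≡ inc f j k j∈I k≢j
  x₁-in {i = i} {k = k} refl j∈I with third i k ∈? I
  ... | yes _   = refl
  ... | no  j∉I = contradiction j∈I j∉I

  x₁-out : ∀ {f i j k} .{i∈I : i ∈ I} .{k≢i : k ≢ i} →
           j ≡ third i k → j ∉ I →
           x₁ (inc f i k i∈I k≢i) ≡ inc (r M j f) i k i∈I k≢i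
  x₁-out {i = i} {k = k} refl j∉I with third i k ∈? I
  ... | yes j∈I = contradiction j∈I j∉I
  ... | no  _   = refl

  x-involutive : ∀ i → Involutive _≡_ (x i)
  x-involutive 0F (inc f i k _ _) = inc-≡ refl refl (third-involutive i k)
  x-involutive 1F y@(inc f i k i∈I k≢i) with third i k ∈? I
  ... | yes _   = x₁-in (sym (third-cancel i k)) (member y)
  ... | no  j∉I = trans (x₁-out refl j∉I) (inc-≡ (r-involutive M _ f) refl refl)
  x-involutive 2F (inc f i k _ _) = inc-≡ (r-involutive M i f) refl refl

  x-fpf : ∀ i y → x i y ≢ y
  x-fpf 0F y e = third≢₂ (side y) (corner y) (apart y) (cong corner e)
  x-fpf 1F y@(inc f i k i∈I k≢i) e with third i k ∈? I
  ... | yes _ = third≢₁ i k (apart y) (cong side e)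
  ... | no  _ = r-fpf M (third i k) f (cong flag e)
  x-fpf 2F y e = r-fpf M (side y) (flag y) (cong flag e)

  private
    Orbit : Subset 3 → XFlag → XFlag → Set
    Orbit = SameOrbit x

    faces : Subset 3
    faces = ∁ ⁅ 2F ⁆

    move : ∀ {J y z} j → j ∈ J → x j y ≡ z → Orbit J y z
    move j j∈J refl = step j j∈J ◅ ε

    1∈faces : 1F ∈ faces
    1∈faces = there here

    same-side : ∀ {y z} → flag y ≡ flag z → side y ≡ side z → Orbit faces y z
    same-side {y} {z} refl refl with corner z ≟ corner y
    ... | yes refl = ε
    ... | no  l≢k  = move 0F here
      (inc-≡ refl refl (sym (two-ends _ _ _ (apart y) (apart z) l≢k)))

    same-flag : ∀ {y z} → flag y ≡ flag z → Orbit faces y z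
    same-flag {y} {z} refl with side z ≟ side y
    ... | yes e   = same-side refl (sym e)
    ... | no  j≢i =
      same-side {z = inc _ i c (member y) c≢i} refl refl ◅◅
      (move 1F 1∈faces (x₁-in {k≢j = c≢j} (sym (third-involutive i j)) (member z)) ◅◅
       same-side refl refl)
      where
      i = side y
      j = side z
      c = third i j
      c≢i : c ≢ i
      c≢i = third≢₁ i j j≢i
      c≢j : c ≢ j
      c≢j = third≢₂ i j j≢i

    same-region : ∀ {f g} → SameOrbit (r M) (∁ I) f g →
                  ∀ {y z} → flag y ≡ f → flag z ≡ g → Orbit faces y z
    same-region ε p q = same-flag (trans p (sym q))
    same-region {f} (step j j∈∁I ◅ s) {y} refl q =
      same-flag {z = inc f i c (member y) c≢i} refl ◅◅
      (move 1F 1∈faces (x₁-out {k≢i = c≢i} (sym (third-involutive i j)) j∉I) ◅◅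
       same-region s refl q)
      where
      i = side y
      c = third i j
      j∉I : j ∉ I
      j∉I = x∈∁p⇒x∉p j∈∁I
      j≢i : j ≢ i
      j≢i e = j∉I (subst (_∈ I) (sym e) (member y))
      c≢i : c ≢ i
      c≢i = third≢₁ i j j≢i

    in-region : ∀ {y z} → Orbit faces y z → SameOrbit (r M) (∁ I) (flag y) (flag z)
    in-region ε = ε
    in-region (step 0F _ ◅ s) = in-region s
    in-region {y = inc f i k _ _} (step 1F _ ◅ s) with third i k ∈? I
    ... | yes _   = in-region s
    ... | no  j∉I = step (third i k) (x∉p⇒x∈∁p j∉I) ◅ in-region s
    in-region (step 2F (there (there ())) ◅ _)

    weaken : ∀ {J y z} → Orbit J y z → Orbit ⊤ y z
    weaken ε              = ε
    weaken (step j _ ◅ s) = step j ∈⊤ ◅ weaken s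

    reach : ∀ {f g} → SameOrbit (r M) ⊤ f g →
            ∀ {y z} → flag y ≡ f → flag z ≡ g → Orbit ⊤ y z
    reach ε p q = weaken (same-flag (trans p (sym q)))
    reach {f} (step j _ ◅ s) {y} refl q with j ∈? I
    ... | no  j∉I =
      weaken (same-region (step j (x∉p⇒x∈∁p j∉I) ◅ ε)
                {z = inc (r M j f) (side y) (corner y) (member y) (apart y)}
                refl refl) ◅◅
      reach s refl q
    ... | yes j∈I =
      weaken (same-flag {z = inc f j c j∈I c≢j} refl) ◅◅
      (move 2F ∈⊤ refl ◅◅ reach s refl q)
      where
      c = punchIn j 0F
      c≢j : c ≢ j
      c≢j = punchInᵢ≢i j 0F

  X : Nonempty I → Map
  X (i , i∈I) = record
    { Flag         = XFlag
    ; size         = size M * (∣ I ∣ * 2)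
    ; finite       = incidences↔ (finite M)
    ; root         = inc (root M) i (punchIn i 0F) i∈I (punchInᵢ≢i i 0F)
    ; r            = x
    ; r-involutive = x-involutive
    ; r-fpf        = x-fpf
    ; r₀r₂-comm    = λ _ → refl
    ; r₀r₂-fpf     = λ y e → third≢₂ (side y) (corner y) (apart y) (cong corner e)
    ; transitive   = λ y z → reach (transitive M (flag y) (flag z)) refl refl
    }

  -- The faces of X(M,I) are the regions formed by conjoining flags of M that
  -- are connected by the r i with i ∉ I.

  faces-are-regions : ∀ ne (y z : Flag (X ne)) →
    SameOrbit (r (X ne)) (∁ ⁅ 2F ⁆) y z ⇔ SameOrbit (r M) (∁ I) (flag y) (flag z)
  faces-are-regions ne y z = mk⇔ in-region (λ s → same-region s refl refl)

data PseudoOrientable (M : Map) : Subset 3 → Set where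
  nonempty : ∀ {I} (ne : Nonempty I) → FacePseudoOrientable (X M I ne) → PseudoOrientable M I
  empty    : Orientable M → PseudoOrientable M ⊥

{-# OPTIONS --safe #-}
module Submission where

-- Orient every triangle f by a parity a f, where 0ℙ stands for the cyclic
-- order ⟨012⟩ of its corners and 1ℙ for ⟨021⟩.  Gluing f to r j f identifies
-- corners with equal numbers, so the two triangles induce the same direction
-- on side j if a (r j f) ≡ a f, and opposite directions otherwise.
--
-- For I = ∅, orientability asks for opposite directions on all sides, so an
-- orientation is just an R-coloring.  For nonempty I, circular arrows in the
-- faces of X(M,I) orient the triangles: a flag y of X(M,I), which is a
-- triangle with a side in I and a corner on it, carries an arrow running along
-- the side, and continuing that arrow around the triangle gives a cyclic order
-- (arrowOrientation y).  The arrow rules make this independent of the chosen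
-- side and corner (same-orientation), so it is a function a of the triangle.
-- Inside a region, across a side of type j ∉ I, the arrow runs past the corner
-- from one triangle to the next, which turns ⟨012⟩ into ⟨021⟩: a changes.
-- Across a side of type j ∈ I the arrows have to agree, so a stays the same.
-- Hence a is an (R ∖ I)-coloring; conversely, an (R ∖ I)-coloring, read as
-- orientations of triangles, gives consistent arrows in the same way.

open import Defs
open import Data.Fin using (Fin; punchIn)
open import Data.Fin.Patterns using (0F; 1F; 2F)
open import Data.Fin.Properties using (_≟_; punchInᵢ≢i)
open import Data.Fin.Subset using (Subset; ∁; _∈_; _∉_; Nonempty; ⊥)
open import Data.Fin.Subset.Properties
  using (_∈?_; nonempty?; Empty-unique; ∉⊥; x∈p⇒x∉∁p; x∈∁p⇒x∉p; x∉p⇒x∈∁p; x∉∁p⇒x∈p)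
open import Data.Parity.Base using (Parity; 0ℙ; 1ℙ; _+_; _⁻¹)
open import Data.Parity.Properties using (p≢p⁻¹; +-cancelʳ-≡)
open import Data.Product using (_×_; _,_; proj₁; proj₂)
open import Function using (_∘_)
open import Function.Bundles
  using (_⇔_; _↔_; mk⇔; mk↔ₛ′; module Equivalence; module Inverse; module Injection)
open import Function.Construct.Symmetry using (↔-sym)
open import Function.Properties.Inverse using (↔⇒↣)
open import Relation.Binary.PropositionalEquality
  using (_≡_; _≢_; refl; sym; trans; cong; cong₂; subst)
open import Relation.Nullary using (yes; no)
open import Relation.Nullary.Negation using (contradiction)

open Map
open CircularArrows
open Incidence using (flag; side; corner)

-- Arithmetic of parities

≢⇒≡⁻¹ : ∀ {p q} → p ≢ q → p ≡ q ⁻¹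
≢⇒≡⁻¹ {0ℙ} {0ℙ} p≢q = contradiction refl p≢q
≢⇒≡⁻¹ {0ℙ} {1ℙ} _   = refl
≢⇒≡⁻¹ {1ℙ} {0ℙ} _   = refl
≢⇒≡⁻¹ {1ℙ} {1ℙ} p≢q = contradiction refl p≢q

⁻¹+⁻¹ : ∀ p q → p ⁻¹ + q ⁻¹ ≡ p + q
⁻¹+⁻¹ 0ℙ 0ℙ = refl
⁻¹+⁻¹ 0ℙ 1ℙ = refl
⁻¹+⁻¹ 1ℙ 0ℙ = refl
⁻¹+⁻¹ 1ℙ 1ℙ = refl

+⁻¹≢+ : ∀ p q → p + q ⁻¹ ≢ p + q
+⁻¹≢+ 0ℙ q e = p≢p⁻¹ q (sym e)
+⁻¹≢+ 1ℙ q e = p≢p⁻¹ (q ⁻¹) (sym e)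

-- Since outgoing is 0ℙ, the orientation with a given flow along side i at the
-- corner k is the sum of the parity of the flow and direction i k (see below).

flow↔ : Flow ↔ Parity
flow↔ = mk↔ₛ′
  (λ { outgoing → 0ℙ ; incoming → 1ℙ })
  (λ { 0ℙ → outgoing ; 1ℙ → incoming })
  (λ { 0ℙ → refl ; 1ℙ → refl })
  (λ { outgoing → refl ; incoming → refl })

order↔ : CyclicOrder ↔ Parity
order↔ = mk↔ₛ′
  (λ { ⟨012⟩ → 0ℙ ; ⟨021⟩ → 1ℙ })
  (λ { 0ℙ → ⟨012⟩ ; 1ℙ → ⟨021⟩ })
  (λ { 0ℙ → refl ; 1ℙ → refl })
  (λ { ⟨012⟩ → refl ; ⟨021⟩ → refl })

module _ {A B : Set} (A↔B : A ↔ B) where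

  to-≢ : ∀ {a b} → a ≢ b → Inverse.to A↔B a ≢ Inverse.to A↔B b
  to-≢ a≢b = a≢b ∘ Injection.injective (↔⇒↣ A↔B)

  from-≢ : ∀ {a b} → a ≢ b → Inverse.from A↔B a ≢ Inverse.from A↔B b
  from-≢ a≢b = a≢b ∘ Injection.injective (↔⇒↣ (↔-sym A↔B))

-- The empty case: orientations of the surface

opposite⇒≢ : ∀ o′ o i → tail o′ i ≡ head o i → o′ ≢ o
opposite⇒≢ o o i e refl = moves o (next o i) (sym e)
  where
  moves : ∀ o k → next o k ≢ k
  moves ⟨012⟩ 0F ()
  moves ⟨012⟩ 1F ()
  moves ⟨012⟩ 2F ()
  moves ⟨021⟩ 0F ()
  moves ⟨021⟩ 1F ()
  moves ⟨021⟩ 2F ()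

≢⇒opposite : ∀ o′ o i → o′ ≢ o → tail o′ i ≡ head o i × head o′ i ≡ tail o i
≢⇒opposite ⟨012⟩ ⟨012⟩ _  o′≢o = contradiction refl o′≢o
≢⇒opposite ⟨021⟩ ⟨021⟩ _  o′≢o = contradiction refl o′≢o
≢⇒opposite ⟨012⟩ ⟨021⟩ 0F _    = refl , refl
≢⇒opposite ⟨012⟩ ⟨021⟩ 1F _    = refl , refl
≢⇒opposite ⟨012⟩ ⟨021⟩ 2F _    = refl , refl
≢⇒opposite ⟨021⟩ ⟨012⟩ 0F _    = refl , refl
≢⇒opposite ⟨021⟩ ⟨012⟩ 1F _    = refl , refl
≢⇒opposite ⟨021⟩ ⟨012⟩ 2F _    = refl , refl

orientable⇔colorable : ∀ M → Orientable M ⇔ Colorable M (∁ ⊥)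
orientable⇔colorable M = mk⇔
  (λ { (o , opposite) → Inverse.to order↔ ∘ o , λ f j →
         (λ _ → to-≢ order↔ (opposite⇒≢ _ _ j (proj₁ (opposite f j)))) ,
         (λ j∉∁⊥ → contradiction (x∉p⇒x∈∁p ∉⊥) j∉∁⊥) })
  (λ { (a , coloring) → Inverse.from order↔ ∘ a , λ f j →
         ≢⇒opposite _ _ j (from-≢ order↔ (proj₁ (coloring f j) (x∉p⇒x∈∁p ∉⊥))) })

-- Directions along the sides of a triangle

-- The direction along side i starting from its end k: it is 0ℙ if the order
-- ⟨012⟩ runs along the side in this direction, and 1ℙ if ⟨021⟩ does.  The
-- values on the diagonal, where k is not an end of side i, are irrelevant.

direction : R → Fin 3 → Parity
direction i k with k ≟ tail ⟨012⟩ i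
... | yes _ = 0ℙ
... | no  _ = 1ℙ

direction-other-end : ∀ i k → k ≢ i → direction i (third i k) ≡ direction i k ⁻¹
direction-other-end 0F 0F k≢i = contradiction refl k≢i
direction-other-end 0F 1F _   = refl
direction-other-end 0F 2F _   = refl
direction-other-end 1F 0F _   = refl
direction-other-end 1F 1F k≢i = contradiction refl k≢i
direction-other-end 1F 2F _   = refl
direction-other-end 2F 0F _   = refl
direction-other-end 2F 1F _   = refl
direction-other-end 2F 2F k≢i = contradiction refl k≢i

-- Of the two sides at a corner, a cyclic order leaves the corner along one and
-- arrives along the other.

direction-other-side : ∀ i k → k ≢ i → direction (third i k) k ≡ direction i k ⁻¹
direction-other-side 0F 0F k≢i = contradiction refl k≢i
direction-other-side 0F 1F _   = refl
direction-other-side 0F 2F _   = refl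
direction-other-side 1F 0F _   = refl
direction-other-side 1F 1F k≢i = contradiction refl k≢i
direction-other-side 1F 2F _   = refl
direction-other-side 2F 0F _   = refl
direction-other-side 2F 1F _   = refl
direction-other-side 2F 2F k≢i = contradiction refl k≢i

-- From arrows to a coloring

module _ (M : Map) (I : Subset 3) (ne : Nonempty I) where

  -- The incidence at f at which the orientation of f is read off; any other
  -- side in I and corner would do.

  chosen : Flag M → Incidence (Flag M) I
  chosen f = inc f i (punchIn i 0F) (proj₂ ne) (punchInᵢ≢i i 0F)
    where i = proj₁ ne

  module _ (A : CircularArrows (X M I ne)) where

    flowParity : Incidence (Flag M) I → Parity
    flowParity = Inverse.to flow↔ ∘ flow A

    -- The cyclic order of the corners of the triangle flag y obtained by
    -- continuing the arrow along side y around the triangle: 0ℙ for ⟨012⟩ and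
    -- 1ℙ for ⟨021⟩.

    arrowOrientation : Incidence (Flag M) I → Parity
    arrowOrientation y = flowParity y + direction (side y) (corner y)

    -- If both the arrow at the corner and the direction are reversed, then the
    -- orientation is unchanged.

    both-reversed : ∀ y z → flow A y ≢ flow A z →
      direction (side y) (corner y) ≡ direction (side z) (corner z) ⁻¹ →
      arrowOrientation y ≡ arrowOrientation z
    both-reversed y z φ≢ e =
      trans (cong₂ _+_ (≢⇒≡⁻¹ (to-≢ flow↔ φ≢)) e)
        (⁻¹+⁻¹ (flowParity z) (direction (side z) (corner z)))

    orientation-other-end : ∀ y → arrowOrientation (x₀ M I y) ≡ arrowOrientation y
    orientation-other-end y =
      both-reversed (x₀ M I y) y (along A y) (direction-other-end _ _ (apart y))

    same-side-orientation : ∀ y z → flag y ≡ flag z → side y ≡ side z →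
      arrowOrientation y ≡ arrowOrientation z
    same-side-orientation y z refl refl with corner z ≟ corner y
    ... | yes refl = refl
    ... | no  l≢k  = trans (sym (orientation-other-end y))
      (cong arrowOrientation
        (inc-≡ refl refl (sym (two-ends _ _ _ (apart y) (apart z) l≢k))))

    same-corner-orientation : ∀ y z → flag y ≡ flag z →
      side z ≡ third (side y) (corner y) → corner y ≡ corner z →
      arrowOrientation z ≡ arrowOrientation y
    same-corner-orientation y z refl refl refl =
      both-reversed z y
        (subst (λ w → flow A w ≢ flow A y) (x₁-in M I refl (member z)) (at-vertex A y))
        (direction-other-side _ _ (apart y))

    -- Two different sides i and j meet in the corner third i j, about which an
    -- arrow turns from one to the other.

    same-orientation : ∀ y z → flag y ≡ flag z → arrowOrientation y ≡ arrowOrientation z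
    same-orientation y z e with side z ≟ side y
    ... | yes j≡i = same-side-orientation y z e (sym j≡i)
    ... | no  j≢i =
      trans (same-side-orientation y y′ refl refl)
        (trans (sym (same-corner-orientation y′ z′ e (sym (third-involutive i j)) refl))
          (same-side-orientation z′ z refl refl))
      where
      i = side y
      j = side z
      y′ = inc (flag y) i (third i j) (member y) (third≢₁ i j j≢i)
      z′ = inc (flag z) j (third i j) (member z) (third≢₂ i j j≢i)

    -- Inside a region the arrow at a corner turns from side i of f to side i of
    -- the neighbouring triangle r j f; it is reversed while the direction is
    -- the same.

    orientation-inside : ∀ y → third (side y) (corner y) ∉ I →
      ∀ z → flag z ≡ r M (third (side y) (corner y)) (flag y) →
      arrowOrientation z ≢ arrowOrientation y
    orientation-inside y j∉I z e z≡y =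
      to-≢ flow↔
        (subst (λ w → flow A w ≢ flow A y) (x₁-out M I refl j∉I) (at-vertex A y))
        (+-cancelʳ-≡ (direction (side y) (corner y)) _ _
          (trans (sym (same-orientation z y′ e)) z≡y))
      where
      y′ = inc (r M (third (side y) (corner y)) (flag y)) (side y) (corner y)
             (member y) (apart y)

    arrows⇒coloring : (∀ y → flow A (x₂ M I y) ≡ flow A y) →
                      IsColoring M (∁ I) (arrowOrientation ∘ chosen)
    arrows⇒coloring cross f j = changes , constant
      where
      i = proj₁ ne

      changes : j ∈ ∁ I →
                arrowOrientation (chosen (r M j f)) ≢ arrowOrientation (chosen f)
      changes j∈∁I e =
        orientation-inside y
          (subst (_∉ I) (sym (third-involutive i j)) j∉I)
          (chosen (r M j f))
          (cong (λ l → r M l f) (sym (third-involutive i j)))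
          (trans e (same-orientation (chosen f) y refl))
        where
        j∉I : j ∉ I
        j∉I = x∈∁p⇒x∉p j∈∁I
        -- Crossing side j leads from side i about the corner common to both.
        y = inc f i (third i j) (proj₂ ne)
              (third≢₁ i j λ j≡i → j∉I (subst (_∈ I) (sym j≡i) (proj₂ ne)))

      constant : j ∉ ∁ I →
                 arrowOrientation (chosen (r M j f)) ≡ arrowOrientation (chosen f)
      constant j∉∁I =
        trans (same-orientation (chosen (r M j f)) (x₂ M I y) refl)
          (trans (cong (λ φ → Inverse.to flow↔ φ + direction j (corner y)) (cross y))
            (same-orientation y (chosen f) refl))
        where
        y = inc f j (punchIn j 0F) (x∉∁p⇒x∈p j∉∁I) (punchInᵢ≢i j 0F)

  -- From a coloring to arrows

  module _ (a : Flag M → Parity) (coloring : IsColoring M (∁ I) a) where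

    -- The flow along side y, away from or towards corner y, of the orientation
    -- a of the triangle flag y.

    inducedFlow : Incidence (Flag M) I → Flow
    inducedFlow y = Inverse.from flow↔ (a (flag y) + direction (side y) (corner y))

    inducedFlow-reversed : ∀ y z → flag y ≡ flag z →
      direction (side y) (corner y) ≡ direction (side z) (corner z) ⁻¹ →
      inducedFlow y ≢ inducedFlow z
    inducedFlow-reversed y z refl e = from-≢ flow↔
      (+⁻¹≢+ (a (flag z)) (direction (side z) (corner z)) ∘
        trans (cong (a (flag z) +_) (sym e)))

    inducedFlow-at-vertex : ∀ y → inducedFlow (x₁ M I y) ≢ inducedFlow y
    inducedFlow-at-vertex y@(inc f i k i∈I k≢i) with third i k ∈? I
    ... | yes j∈I =
      inducedFlow-reversed (inc f (third i k) k j∈I (third≢₂ i k (apart y) ∘ sym)) y refl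
        (direction-other-side i k (apart y))
    ... | no  j∉I = from-≢ flow↔
      (proj₁ (coloring f (third i k)) (x∉p⇒x∈∁p j∉I) ∘ +-cancelʳ-≡ (direction i k) _ _)

    inducedArrows : CircularArrows (X M I ne)
    inducedArrows = record
      { flow      = inducedFlow
      ; along     = λ y →
          inducedFlow-reversed (x₀ M I y) y refl (direction-other-end _ _ (apart y))
      ; at-vertex = inducedFlow-at-vertex
      }

    inducedFlow-across : ∀ y → inducedFlow (x₂ M I y) ≡ inducedFlow y
    inducedFlow-across y =
      cong (λ p → Inverse.from flow↔ (p + direction (side y) (corner y)))
        (proj₂ (coloring (flag y) (side y)) (x∈p⇒x∉∁p (member y)))

  facePseudoOrientable⇔colorable : FacePseudoOrientable (X M I ne) ⇔ Colorable M (∁ I)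
  facePseudoOrientable⇔colorable = mk⇔
    (λ { (A , cross) → arrowOrientation A ∘ chosen , arrows⇒coloring A cross })
    (λ { (a , coloring) → inducedArrows a coloring , inducedFlow-across a coloring })

theorem5p4 : (M : Map) (I : Subset 3) → PseudoOrientable M I ⇔ Colorable M (∁ I)
theorem5p4 M I = mk⇔ pseudoOrientable⇒colorable (colorable⇒pseudoOrientable I)
  where
  pseudoOrientable⇒colorable : ∀ {I} → PseudoOrientable M I → Colorable M (∁ I)
  pseudoOrientable⇒colorable (nonempty ne P) =
    Equivalence.to (facePseudoOrientable⇔colorable M _ ne) P
  pseudoOrientable⇒colorable (empty O) = Equivalence.to (orientable⇔colorable M) O

  colorable⇒pseudoOrientable : ∀ I → Colorable M (∁ I) → PseudoOrientable M I
  colorable⇒pseudoOrientable I C with nonempty? I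
  ... | yes ne = nonempty ne (Equivalence.from (facePseudoOrientable⇔colorable M I ne) C)
  ... | no  ¬ne with refl ← Empty-unique ¬ne =
    empty (Equivalence.from (orientable⇔colorable M) C)
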